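{- For each $n\in\mathbb{N}$ there is a first-order formula $\varphi_n(x)$ in the vocabulary $\{R\}$ that separates the classes $\mathbb{A}_n$ and $\mathbb{B}_n$, such that the size of $\varphi_n(x)$ is at most exponential in $n$, namely $\mathrm{s}(\varphi_n)=\mathcal{O}(2^n)$ (there is a constant $C$ with $\mathrm{s}(\varphi_n)\le C\cdot 2^n$ for all $n$).
   Context: $\mathbb{N}$ includes $0$. The set of proposition symbols is empty. A pointed frame is a pair $(\mathcal{M},w)$ where $\mathcal{M}=(W,R)$ with $R\subseteq W\times W$ and $w\in W$. Write $\Box(\mathcal{M},w)=\{(\mathcal{M},v)\mid wR^{\mathcal{M}}v\}$. $(\mathcal{M},w)$ and $(\mathcal{M}',w')$ are $n$-bisimilar if there are binary relations $Z_n\subseteq\dots\subseteq Z_0$ between points of $\mathcal{M}$ and points of $\mathcal{M}'$ such that $wZ_nw'$ and for every $0\le i\le n-1$: if $vZ_{i+1}v'$ and $vR^{\mathcal{M}}u$ then there is $u'$ with $v'R^{\mathcal{M}'}u'$ and $uZ_iu'$; and if $vZ_{i+1}v'$ and $v'R^{\mathcal{M}'}u'$ then there is $u$ with $vR^{\mathcal{M}}u$ and $uZ_iu'$. $\mathbb{A}_n$ is the class of all pointed frames $(\mathcal{A},w)$ such that for all $(\mathcal{A},u),(\mathcal{A},v)\in\Box(\mathcal{A},w)$ the pointed frames $(\mathcal{A},u)$ and $(\mathcal{A},v)$ are $n$-bisimilar; $\mathbb{B}_n$ is the complement of $\mathbb{A}_n$ in the class of all pointed frames. A first-order formula $\psi(x)$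 separates $\mathbb{A}$ and $\mathbb{B}$ if $\mathcal{M}\vDash\psi[w/x]$ for all $(\mathcal{M},w)\in\mathbb{A}$ and $\mathcal{M}\vDash\neg\psi[w/x]$ for all $(\mathcal{M},w)\in\mathbb{B}$. The size of a first-order formula is the number of its binary connectives and quantifiers: $\mathrm{s}(\varphi)=0$ for literals, $\mathrm{s}(\neg\psi)=\mathrm{s}(\psi)$, $\mathrm{s}(\psi\vee\vartheta)=\mathrm{s}(\psi\wedge\vartheta)=\mathrm{s}(\psi)+\mathrm{s}(\vartheta)+1$, $\mathrm{s}(\exists x\psi)=\mathrm{s}(\forall x\psi)=\mathrm{s}(\psi)+1$ (implications and equivalences are standard shorthands). -}

module Defs where

open import Level using (Level; suc)
open import Data.Nat.Base as ℕ using (ℕ; _+_)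
open import Data.Fin.Base using (Fin; inject₁; fromℕ)
  renaming (suc to fsuc)
open import Data.Vec.Base using (Vec; []; _∷_; lookup)
open import Data.Product.Base using (_×_; ∃-syntax)
open import Data.Sum.Base using (_⊎_)
open import Relation.Binary.Core using (Rel; REL; _⇒_)
open import Relation.Binary.PropositionalEquality.Core using (_≡_)
open import Relation.Nullary.Negation.Core using (¬_)
open import Relation.Unary using (Pred; ∁; _∈_)

private
  variable
    ℓ a b : Level
    k : ℕ

record Frame (ℓ : Level) : Set (suc ℓ) where
  field
    W : Set ℓ
    R : Rel W ℓ

record PointedFrame (ℓ : Level) : Set (suc ℓ) where
  constructor _,_
  field
    frame : Frame ℓ
    point : Frame.W frame

-- There are no proposition symbols, so Z₀ carries no condition of its own.
record Bisimilar (n : ℕ) (p p′ : PointedFrame ℓ) : Set (suc ℓ) where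
  open PointedFrame p using () renaming (frame to M; point to w)
  open PointedFrame p′ using () renaming (frame to M′; point to w′)
  open Frame M
  open Frame M′ renaming (W to W′; R to R′)
  field
    Z          : Fin (ℕ.suc n) → REL W W′ ℓ
    decreasing : ∀ (i : Fin n) → Z (fsuc i) ⇒ Z (inject₁ i)
    related    : Z (fromℕ n) w w′
    forth      : ∀ (i : Fin n) {v v′ u} → Z (fsuc i) v v′ → R v u →
                 ∃[ u′ ] (R′ v′ u′ × Z (inject₁ i) u u′)
    back       : ∀ (i : Fin n) {v v′ u′} → Z (fsuc i) v v′ → R′ v′ u′ →
                 ∃[ u ] (R v u × Z (inject₁ i) u u′)

𝔸 : ℕ → Pred (PointedFrame ℓ) (suc ℓ)
𝔸 n (A , w) = ∀ u v → R w u → R w v → Bisimilar n (A , u) (A , v)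
  where open Frame A

𝔹 : ℕ → Pred (PointedFrame ℓ) (suc ℓ)
𝔹 n = ∁ (𝔸 n)

-- First-order logic with equality over {R}, in well-scoped de Bruijn form:
-- the free variables of a Formula k are among Fin k, and a quantifier binds
-- index zero.  A formula ψ(x) is a Formula 1.
infix  8 _≐_
infix  7 ∼_
infixr 6 _∧_
infixr 5 _∨_

data Formula (k : ℕ) : Set where
  rel     : (x y : Fin k) → Formula k
  _≐_     : (x y : Fin k) → Formula k
  ∼_      : Formula k → Formula k
  _∧_ _∨_ : Formula k → Formula k → Formula k
  all ex  : Formula (ℕ.suc k) → Formula k

size : Formula k → ℕ
size (rel x y) = 0
size (x ≐ y)   = 0
size (∼ ψ)     = size ψ
size (ψ ∧ θ)   = size ψ + size θ + 1
size (ψ ∨ θ)   = size ψ + size θ + 1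
size (all ψ)   = size ψ + 1
size (ex ψ)    = size ψ + 1

infix 4 _⊨_[_]

_⊨_[_] : (M : Frame ℓ) → Formula k → Vec (Frame.W M) k → Set ℓ
M ⊨ rel x y [ ρ ] = Frame.R M (lookup ρ x) (lookup ρ y)
M ⊨ x ≐ y   [ ρ ] = lookup ρ x ≡ lookup ρ y
M ⊨ ∼ ψ     [ ρ ] = ¬ (M ⊨ ψ [ ρ ])
M ⊨ ψ ∧ θ   [ ρ ] = (M ⊨ ψ [ ρ ]) × (M ⊨ θ [ ρ ])
M ⊨ ψ ∨ θ   [ ρ ] = (M ⊨ ψ [ ρ ]) ⊎ (M ⊨ θ [ ρ ])
M ⊨ all ψ   [ ρ ] = ∀ v → M ⊨ ψ [ v ∷ ρ ]
M ⊨ ex ψ    [ ρ ] = ∃[ v ] (M ⊨ ψ [ v ∷ ρ ])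

record Separates (ψ : Formula 1) (A : Pred (PointedFrame ℓ) a)
                 (B : Pred (PointedFrame ℓ) b) : Set (suc ℓ Level.⊔ a Level.⊔ b) where
  field
    holds : ∀ M w → (M , w) ∈ A → M ⊨ ψ [ w ∷ [] ]
    fails : ∀ M w → (M , w) ∈ B → M ⊨ ∼ ψ [ w ∷ [] ]

{-# OPTIONS --safe #-}
module Submission where

-- The largest candidate for Zₙ satisfies a recursion on n whose step mentions
-- its predecessor twice, once for forth and once for back; hence the 2ⁿ.

open import Data.Nat.Base using (ℕ; _*_; _^_; _≤_)
open import Data.Product.Base using (_×_; ∃-syntax)
open import Axiom.ExcludedMiddle using (ExcludedMiddle)
open import Defs

open import Level using (Level)
open import Data.Nat.Base using (zero; suc; _+_)
open import Data.Nat.Properties using (≤-reflexive; ≤-trans; m≤m+n)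
open import Data.Nat.Tactic.RingSolver using (solve-∀)
open import Data.Fin.Base using (Fin; toℕ; fromℕ; inject₁)
open import Data.Fin.Patterns using (0F; 1F; 2F)
open import Data.Fin.Properties using (toℕ-inject₁; toℕ-fromℕ)
open import Data.Fin.Induction using (<-weakInduction)
open import Data.Product.Base using (_,_)
open import Data.Sum.Base using (inj₁; inj₂)
open import Data.Unit.Polymorphic.Base using (⊤)
open import Data.Vec.Base using (Vec; []; _∷_; lookup)
open import Function.Base using (_∘_)
open import Relation.Binary.Core using (REL; _⇒_)
open import Relation.Binary.PropositionalEquality
  using (_≡_; refl; sym; trans; cong; subst; module ≡-Reasoning)
open import Relation.Nullary.Decidable.Core using (yes; no)
open import Relation.Nullary.Negation.Core using (contradiction)

private
  variable
    ℓ : Level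
    k : ℕ

-- Having a chain of relations as in `Bisimilar` is a second-order condition, but a greatest chain
-- exists and its levels `Bis n` are given by unfolding forth and back. Thus `Bisimilar n` and
-- `Bis n` coincide, and each unfolding is first-order: `bisᶠ n` expresses `Bis n` within one frame,
-- and `φ n` asks it of every two successors of the point. If `bisᶠ n` has size s, then
-- `bisᶠ (suc n)` has size 2s + 9, which solves to 9 * 2 ^ n - 9.

module _ (M M′ : Frame ℓ) where
  open Frame M
  open Frame M′ renaming (W to W′; R to R′)

  Bis : ℕ → REL W W′ ℓ
  Bis zero    v v′ = ⊤
  Bis (suc n) v v′ =
    (∀ u → R v u → ∃[ u′ ] (R′ v′ u′ × Bis n u u′)) ×
    (∀ u′ → R′ v′ u′ → ∃[ u ] (R v u × Bis n u u′))

  Bis-decreasing : ∀ n → Bis (suc n) ⇒ Bis n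
  Bis-decreasing zero    _             = _
  Bis-decreasing (suc n) (forth , back) =
    (λ u r → let u′ , r′ , b = forth u r in u′ , r′ , Bis-decreasing n b) ,
    (λ u′ r′ → let u , r , b = back u′ r′ in u , r , Bis-decreasing n b)

  Bis⇒Bisimilar : ∀ n {w w′} → Bis n w w′ → Bisimilar n (M , w) (M′ , w′)
  Bis⇒Bisimilar n {w} {w′} b = record
    { Z          = Bis ∘ toℕ
    ; decreasing = λ i → reindex i ∘ Bis-decreasing (toℕ i)
    ; related    = subst (λ m → Bis m w w′) (sym (toℕ-fromℕ n)) b
    ; forth      = λ { i (forth , _) r →
                     let u′ , r′ , b′ = forth _ r in u′ , r′ , reindex i b′ }
    ; back       = λ { i (_ , back) r′ →
                     let u , r , b′ = back _ r′ in u , r , reindex i b′ }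
    }
    where
    reindex : (i : Fin n) → Bis (toℕ i) ⇒ Bis (toℕ (inject₁ i))
    reindex i {v} {v′} = subst (λ m → Bis m v v′) (sym (toℕ-inject₁ i))

  -- Maximality of `Bis`: by induction on the level, forth and back push any chain into it, starting
  -- from the total relation at level 0.
  Bisimilar⇒Bis : ∀ n {w w′} → Bisimilar n (M , w) (M′ , w′) → Bis n w w′
  Bisimilar⇒Bis n {w} {w′} B =
    subst (λ m → Bis m w w′) (toℕ-fromℕ n) (Z⇒Bis (fromℕ n) related)
    where
    open Bisimilar B
    reindex : (i : Fin n) → Bis (toℕ (inject₁ i)) ⇒ Bis (toℕ i)
    reindex i {v} {v′} = subst (λ m → Bis m v v′) (toℕ-inject₁ i)

    Z⇒Bis : ∀ i {v v′} → Z i v v′ → Bis (toℕ i) v v′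
    Z⇒Bis = <-weakInduction (λ i → ∀ {v v′} → Z i v v′ → Bis (toℕ i) v v′)
      (λ _ → _)
      λ i ih z →
        (λ u r → let u′ , r′ , z′ = forth i z r in u′ , r′ , reindex i (ih z′)) ,
        (λ u′ r′ → let u , r , z′ = back i z r′ in u , r , reindex i (ih z′))

infixr 4 _⊃_

_⊃_ : Formula k → Formula k → Formula k
ψ ⊃ θ = ∼ ψ ∨ θ

bisᶠ : ℕ → (x y : Fin k) → Formula k
-- A tautology of size 0, standing for truth.
bisᶠ zero    x y = x ≐ x
bisᶠ (suc n) x y =
  all (rel (Fin.suc x) 0F ⊃ ex (rel (Fin.suc (Fin.suc y)) 0F ∧ bisᶠ n 1F 0F)) ∧
  -- Here the universal variable is the successor of `y` and the witness that of `x`, so the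
  -- recursive call swaps the indices.
  all (rel (Fin.suc y) 0F ⊃ ex (rel (Fin.suc (Fin.suc x)) 0F ∧ bisᶠ n 0F 1F))

φ : ℕ → Formula 1
φ n = all (all (rel 2F 1F ⊃ rel 2F 0F ⊃ bisᶠ n 1F 0F))

-- Forth and back each add two quantifiers, a disjunction (from `⊃`) and a conjunction; one more
-- conjunction joins them, making 9. Adding 9 to the size turns the recurrence into pure doubling.
size-bisᶠ : ∀ n (x y : Fin k) → size (bisᶠ n x y) + 9 ≡ 9 * 2 ^ n
size-bisᶠ zero    x y = refl
size-bisᶠ {k} (suc n) x y = begin
  size (bisᶠ (suc n) x y) + 9  ≡⟨ regroup s t ⟩
  (s + 9) + (t + 9)            ≡⟨ cong (_+ (t + 9)) (size-bisᶠ n 1F 0F) ⟩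
  9 * 2 ^ n + (t + 9)          ≡⟨ cong (9 * 2 ^ n +_) (size-bisᶠ n 0F 1F) ⟩
  9 * 2 ^ n + 9 * 2 ^ n        ≡⟨ double (2 ^ n) ⟩
  9 * 2 ^ suc n                ∎
  where
  open ≡-Reasoning
  s t : ℕ
  s = size (bisᶠ {suc (suc k)} n 1F 0F)
  t = size (bisᶠ {suc (suc k)} n 0F 1F)
  regroup : ∀ a b → (a + 1 + 1 + 1 + 1) + (b + 1 + 1 + 1 + 1) + 1 + 9 ≡ (a + 9) + (b + 9)
  regroup = solve-∀
  double : ∀ a → 9 * a + 9 * a ≡ 9 * (2 * a)
  double = solve-∀

size-φ : ∀ n → size (φ n) ≤ 9 * 2 ^ n
-- `φ` adds 4 to the size of `bisᶠ`, leaving a slack of 9 - 4 = 5.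
size-φ n = ≤-trans (m≤m+n (size (φ n)) 5)
  (≤-reflexive (trans (regroup s) (size-bisᶠ {3} n 1F 0F)))
  where
  s : ℕ
  s = size (bisᶠ {3} n 1F 0F)
  regroup : ∀ a → a + 1 + 1 + 1 + 1 + 5 ≡ a + 9
  regroup = solve-∀

module _ (M : Frame ℓ) where
  open Frame M

  ⊃-elim : (ψ θ : Formula k) {ρ : Vec W k} → M ⊨ ψ ⊃ θ [ ρ ] → M ⊨ ψ [ ρ ] → M ⊨ θ [ ρ ]
  ⊃-elim ψ θ (inj₁ ¬p) p = contradiction p ¬p
  ⊃-elim ψ θ (inj₂ q)  p = q

  -- Since `⊃` is a disjunction, the antecedent has to be decided; this is where excluded middle
  -- enters.
  ⊃-intro : ExcludedMiddle ℓ → (ψ θ : Formula k) {ρ : Vec W k} →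
            (M ⊨ ψ [ ρ ] → M ⊨ θ [ ρ ]) → M ⊨ ψ ⊃ θ [ ρ ]
  ⊃-intro em ψ θ {ρ} f with em {M ⊨ ψ [ ρ ]}
  ... | yes p = inj₂ (f p)
  ... | no ¬p = inj₁ ¬p

  ⊨bisᶠ⇒Bis : ∀ n (x y : Fin k) {ρ : Vec W k} →
              M ⊨ bisᶠ n x y [ ρ ] → Bis M M n (lookup ρ x) (lookup ρ y)
  ⊨bisᶠ⇒Bis zero    x y _              = _
  ⊨bisᶠ⇒Bis (suc n) x y {ρ} (forth , back) =
    (λ u r → let u′ , r′ , b = ⊃-elim (rel (Fin.suc x) 0F)
                          (ex (rel (Fin.suc (Fin.suc y)) 0F ∧ bisᶠ n 1F 0F)) {u ∷ ρ} (forth u) r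
             in u′ , r′ , ⊨bisᶠ⇒Bis n 1F 0F b) ,
    (λ u′ r′ → let u , r , b = ⊃-elim (rel (Fin.suc y) 0F)
                          (ex (rel (Fin.suc (Fin.suc x)) 0F ∧ bisᶠ n 0F 1F)) {u′ ∷ ρ} (back u′) r′
               in u , r , ⊨bisᶠ⇒Bis n 0F 1F b)

  Bis⇒⊨bisᶠ : ExcludedMiddle ℓ → ∀ n (x y : Fin k) {ρ : Vec W k} →
              Bis M M n (lookup ρ x) (lookup ρ y) → M ⊨ bisᶠ n x y [ ρ ]
  Bis⇒⊨bisᶠ em zero    x y _              = refl
  Bis⇒⊨bisᶠ em (suc n) x y {ρ} (forth , back) =
    (λ u → ⊃-intro em (rel (Fin.suc x) 0F)
       (ex (rel (Fin.suc (Fin.suc y)) 0F ∧ bisᶠ n 1F 0F)) {u ∷ ρ} λ r →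
       let u′ , r′ , b = forth u r in u′ , r′ , Bis⇒⊨bisᶠ em n 1F 0F b) ,
    (λ u′ → ⊃-intro em (rel (Fin.suc y) 0F)
       (ex (rel (Fin.suc (Fin.suc x)) 0F ∧ bisᶠ n 0F 1F)) {u′ ∷ ρ} λ r′ →
       let u , r , b = back u′ r′ in u , r , Bis⇒⊨bisᶠ em n 0F 1F b)

φ-separates : ExcludedMiddle ℓ → ∀ n → Separates {ℓ} (φ n) (𝔸 n) (𝔹 n)
φ-separates em n = record
  { holds = λ M w a u v →
      ⊃-intro M em (rel 2F 1F) (rel 2F 0F ⊃ bisᶠ n 1F 0F) λ r →
      ⊃-intro M em (rel 2F 0F) (bisᶠ n 1F 0F) λ r′ →
      Bis⇒⊨bisᶠ M em n 1F 0F (Bisimilar⇒Bis M M n (a u v r r′))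
  -- Contrapositive: truth of `φ n` at a point puts it in `𝔸 n`, and this direction is constructive.
  ; fails = λ M w ¬a h → ¬a λ u v r r′ →
      Bis⇒Bisimilar M M n (⊨bisᶠ⇒Bis M n 1F 0F
        (⊃-elim M (rel 2F 0F) (bisᶠ n 1F 0F)
          (⊃-elim M (rel 2F 1F) (rel 2F 0F ⊃ bisᶠ n 1F 0F) (h u v) r) r′))
  }

lemma4p1 : ∀ {ℓ} → ExcludedMiddle ℓ →
    ∃[ C ] ∀ (n : ℕ) → ∃[ φ ] (Separates {ℓ} φ (𝔸 n) (𝔹 n) × size φ ≤ C * 2 ^ n)
lemma4p1 em = 9 , λ n → φ n , φ-separates em n , size-φ n
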